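{- Let $q$ and $t$ be positive integers and let $H$ be a $q$-uniform, $M_{\aleph_0}^{(q)}(t)$-free hypergraph. If $H$ contains arbitrarily large finite independent sets, then $H$ contains an infinite independent set.
   Context: A $q$-uniform hypergraph consists of a (possibly infinite) vertex set and a collection of $q$-element subsets of it, called edges. A set of vertices is independent if it contains no edge. $M_{\aleph_0}^{(q)}(t)$ denotes the class of all $q$-uniform hypergraphs whose vertex set is the disjoint union of countably infinitely many parts, each of size $t$, such that every $q$-element set of vertices meeting each part in at most one vertex is an edge, and no edge is contained in a single part. There is no restriction on the remaining $q$-element sets (those meeting more than one but fewer than $q$ parts): each may or may not be an edge. A $q$-uniform hypergraph $H$ is $M_{\aleph_0}^{(q)}(t)$-free if no induced subhypergraph of $H$ is isomorphic to a member of this class. -}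

module Defs where

open import Data.Fin using (Fin)
open import Data.Nat using (ℕ; _≤_)
open import Data.Product using (∃; ∃-syntax; _×_; _,_; proj₁; proj₂)
open import Data.Refinement using (Refinement; value)
open import Data.Refinement.Properties using (value-injective)
open import Function.Bundles using (_⇔_; _↔_; Inverse)
open import Function.Definitions using (Injective)
open import Level using (Level; _⊔_; suc)
open import Relation.Binary.Definitions using (_Respects_)
open import Relation.Binary.PropositionalEquality using (_≡_; refl; sym; trans; cong; subst)
open import Relation.Nullary using (¬_)
open import Relation.Unary using (Pred; _∈_; _⊆_; _≐_)

private
  variable
    a b p e : Level
    A : Set a
    B : Set b
    q : ℕ

range : (A → B) → Pred B _
range f y = ∃[ x ] f x ≡ y

image : (A → B) → Pred A p → Pred B _
image f P y = ∃[ x ] x ∈ P × f x ≡ y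

-- Elements are counted in A itself rather than in the Σ-type ∃ P, so that
-- distinct proofs of x ∈ P do not contribute separately.
HasSize : {A : Set a} → Pred A p → ℕ → Set (a ⊔ p)
HasSize {A = A} P n =
  ∃[ f ] Injective {A = Fin n} {B = A} _≡_ _≡_ f × P ≐ range f

Infinite : {A : Set a} → Pred A p → Set (a ⊔ p)
Infinite P = ¬ (∃[ n ] HasSize P n)

-- Subsets are predicates, so the edge collection has to respect
-- extensional equality of subsets.
record Hypergraph (q : ℕ) (a e : Level) : Set (suc (a ⊔ e)) where
  field
    Vertex    : Set a
    Edge      : Pred (Pred Vertex a) e
    edge-resp : Edge Respects _≐_
    edge-size : ∀ {S} → Edge S → HasSize S q

open Hypergraph public

Independent : (H : Hypergraph q a e) → Pred (Vertex H) a → Set (suc a ⊔ e)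
Independent H I = ∀ {S} → Edge H S → ¬ (S ⊆ I)

image-resp : (f : A → B) {P Q : Pred A p} → P ≐ Q → image f P ≐ image f Q
image-resp f (P⊆Q , Q⊆P) =
  (λ { (x , x∈P , eq) → x , P⊆Q x∈P , eq }) ,
  (λ { (x , x∈Q , eq) → x , Q⊆P x∈Q , eq })

image-size⁻ : {f : A → B} → Injective _≡_ _≡_ f → {P : Pred A p} {n : ℕ} →
              HasSize (image f P) n → HasSize P n
image-size⁻ {f = f} f-inj {P} (g , g-inj , im⊆g , g⊆im) =
  h , h-inj , P⊆h , h⊆P
  where
  h = λ i → proj₁ (g⊆im (i , refl))

  h∈P : ∀ i → h i ∈ P
  h∈P i = proj₁ (proj₂ (g⊆im (i , refl)))

  fh≡g : ∀ i → f (h i) ≡ g i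
  fh≡g i = proj₂ (proj₂ (g⊆im (i , refl)))

  h-inj : Injective _≡_ _≡_ h
  h-inj {i} {j} eq = g-inj (trans (sym (fh≡g i)) (trans (cong f eq) (fh≡g j)))

  P⊆h : P ⊆ range h
  P⊆h {x} x∈P with im⊆g (x , x∈P , refl)
  ... | i , gi≡fx = i , f-inj (trans (fh≡g i) gi≡fx)

  h⊆P : range h ⊆ P
  h⊆P (i , hi≡x) = subst P hi≡x (h∈P i)

-- Refinement makes membership in W proof-irrelevant, so every element of W
-- gives exactly one vertex.
induced : (H : Hypergraph q a e) → Pred (Vertex H) a → Hypergraph q a e
induced H W = record
  { Vertex    = Refinement (Vertex H) W
  ; Edge      = λ S → Edge H (image value S)
  ; edge-resp = λ S≐T → edge-resp H (image-resp value S≐T)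
  ; edge-size = λ E → image-size⁻ value-injective (edge-size H E)
  }

record _≅_ (G H : Hypergraph q a e) : Set (suc a ⊔ e) where
  field
    bijection : Vertex G ↔ Vertex H
    edges     : ∀ S → Edge G S ⇔ Edge H (image (Inverse.to bijection) S)

-- Parts are indexed by ℕ; q-sets meeting more than one but fewer than q parts
-- are unconstrained.
record InM (t : ℕ) {q : ℕ} (G : Hypergraph q a e) : Set (suc a ⊔ e) where
  field
    part       : ℕ → Pred (Vertex G) a
    part-size  : ∀ i → HasSize (part i) t
    covering   : ∀ v → ∃[ i ] v ∈ part i
    disjoint   : ∀ {i j v} → v ∈ part i → v ∈ part j → i ≡ j
    transverse : ∀ {S} → HasSize S q →
                 (∀ i {u v} → u ∈ S → v ∈ S → u ∈ part i → v ∈ part i → u ≡ v) →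
                 Edge G S
    no-inner   : ∀ {S} → Edge G S → ∀ i → ¬ (S ⊆ part i)

MFree : ℕ → Hypergraph q a e → Set (suc (a ⊔ e))
MFree {q} {a} {e} t H =
  ∀ (W : Pred (Vertex H) a) (G : Hypergraph q a e) → InM t G → ¬ (induced H W ≅ G)

ArbitrarilyLargeFiniteIndependent : Hypergraph q a e → Set (suc a ⊔ e)
ArbitrarilyLargeFiniteIndependent H =
  ∀ n → ∃[ m ] n ≤ m × (∃[ I ] HasSize I m × Independent H I)

HasInfiniteIndependent : Hypergraph q a e → Set (suc a ⊔ e)
HasInfiniteIndependent H = ∃[ I ] Infinite I × Independent H I

{-# OPTIONS --safe #-}

-- Choose pairwise disjoint independent blocks {x b 0, …, x b b}. By Ramsey's
-- theorem for 2q-tuples there is an infinite set Y of naturals such that, for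
-- a₁ < b₁ < a₂ < b₂ < … < a_q < b_q in Y, either {x b₁ a₁, …, x b_q a_q} is
-- always an edge or it never is. Cut Y into consecutive windows of t + 1 elements
-- i₁ < … < i_t < n: each gives an independent t-set x n i₁, …, x n i_t. Elements
-- from q distinct windows always have indices interleaved as above. So if the
-- answer is "always", the windows are the parts of a member of M(t); if it is
-- "never", one element from each window gives an infinite independent set.
module Submission where

open import Defs
open import Axiom.ExcludedMiddle using (ExcludedMiddle)
open import Data.Bool using (Bool; true; false)
import Data.Bool as Bool
open import Data.Empty using (⊥-elim)
open import Data.Fin using (Fin; zero; suc; toℕ; inject≤; punchIn)
open import Data.Fin.Properties
  using (toℕ<n; toℕ-injective; toℕ-fromℕ<; inject≤-injective; punchIn-injective; punchInᵢ≢i; suc-injective; pigeonhole)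
open import Data.Irrelevant using ([_])
open import Data.List using (List; []; _∷_; _++_; map; length; tabulate)
open import Data.List.Membership.Propositional using (_∉_) renaming (_∈_ to _∈ˡ_)
open import Data.List.Membership.Propositional.Properties
  using (∈-tabulate⁺; ∈-tabulate⁻; ∈-map⁺; ∈-map⁻; ∈-++⁺ˡ; ∈-++⁺ʳ)
open import Data.List.Properties using (length-tabulate)
open import Data.List.Relation.Binary.Permutation.Propositional using (_↭_; ↭-sym; ↭⇒↭ₛ)
open import Data.List.Relation.Binary.Permutation.Propositional.Properties using (∈-resp-↭; ↭-length)
import Data.List.Relation.Binary.Permutation.Setoid.Properties as Permutationₛ
open import Data.List.Relation.Unary.All using (All; []; _∷_)
import Data.List.Relation.Unary.All as All
open import Data.List.Relation.Unary.AllPairs using (AllPairs; []; _∷_)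
import Data.List.Relation.Unary.AllPairs as AllPairs
import Data.List.Relation.Unary.AllPairs.Properties as AllPairs
open import Data.List.Relation.Unary.Any using (here; there)
open import Data.List.Relation.Unary.Sorted.TotalOrder.Properties using (Sorted⇒AllPairs)
import Data.List.Sort
open import Data.Nat using (ℕ; zero; suc; _+_; _*_; _≤_; _<_; _⊔_; z≤n; s≤s⁻¹; NonZero)
open import Data.Nat.DivMod using (_mod_; m≤n⇒m%n≡m)
open import Data.Nat.Properties
  using (≤-refl; ≤-trans; ≤-<-trans; <-≤-trans; <-trans; <-irrefl; <⇒≤; ≤∧≢⇒<; <-cmp; n<1+n;
         m≤m⊔n; m≤n⊔m; m≤m+n; +-comm; +-monoʳ-<; *-monoˡ-≤; +-cancelˡ-≡; m≤n⇒m<n∨m≡n; ≤-decTotalOrder)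
open import Data.Product using (∃; ∃-syntax; _×_; _,_; proj₁; proj₂)
open import Data.Refinement using (value)
open import Data.Refinement.Base using (_,_)
open import Data.Refinement.Properties using (value-injective)
open import Data.Sum using (inj₁; inj₂)
open import Function using (_∘_; _on_; id)
open import Function.Bundles using (mk⇔)
open import Function.Construct.Identity using (↔-id)
open import Function.Definitions using (Injective)
open import Level using (Level; 0ℓ)
open import Relation.Binary.Bundles using (DecTotalOrder)
import Relation.Binary.Construct.On as On
open import Relation.Binary.Definitions using (tri<; tri≈; tri>)
open import Relation.Binary.PropositionalEquality
  using (_≡_; _≢_; refl; sym; trans; cong; cong₂; subst; subst₂; setoid; resp₂; ≢-sym)
open import Relation.Nullary using (¬_; Dec; yes; no; does; contradiction)
open import Relation.Nullary.Decidable using (recompute)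
open import Relation.Unary using (Pred; _∈_; _⊆_; _≐_)

-- Unbounded sets of naturals and increasing sequences

Unbounded : Pred ℕ 0ℓ → Set
Unbounded X = ∀ n → ∃[ m ] n ≤ m × m ∈ X

-- An `r`-element set of naturals is encoded by its strictly increasing list; the values of `c` on
-- other lists do not matter.
Homogeneous : ℕ → (List ℕ → Bool) → Pred ℕ 0ℓ → Bool → Set
Homogeneous r c X b = ∀ {xs} → length xs ≡ r → AllPairs _<_ xs → All X xs → c xs ≡ b

StrictlyIncreasing : (ℕ → ℕ) → Set
StrictlyIncreasing f = ∀ {m n} → m < n → f m < f n

successively : {f : ℕ → ℕ} → (∀ n → f n < f (suc n)) → StrictlyIncreasing f
successively step {m} {suc n} m<1+n with m≤n⇒m<n∨m≡n (s≤s⁻¹ m<1+n)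
... | inj₁ m<n  = <-trans (successively step m<n) (step n)
... | inj₂ refl = step n

module _ {f : ℕ → ℕ} (f-inc : StrictlyIncreasing f) where

  increasing-reflects : ∀ {m n} → f m < f n → m < n
  increasing-reflects {m} {n} fm<fn with <-cmp m n
  ... | tri< m<n _ _  = m<n
  ... | tri≈ _ refl _ = contradiction fm<fn (<-irrefl refl)
  ... | tri> _ _ n<m  = contradiction (<-trans fm<fn (f-inc n<m)) (<-irrefl refl)

  increasing-injective : Injective _≡_ _≡_ f
  increasing-injective {m} {n} fm≡fn with <-cmp m n
  ... | tri< m<n _ _ = contradiction (f-inc m<n) (<-irrefl fm≡fn)
  ... | tri≈ _ m≡n _ = m≡n
  ... | tri> _ _ n<m = contradiction (f-inc n<m) (<-irrefl (sym fm≡fn))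

  increasing-expansive : ∀ n → n ≤ f n
  increasing-expansive zero    = z≤n
  increasing-expansive (suc n) = ≤-<-trans (increasing-expansive n) (f-inc (n<1+n n))

enumerate : ∀ {X} → Unbounded X → ∃[ f ] StrictlyIncreasing f × (∀ n → f n ∈ X)
enumerate {X} unb = f , successively (λ n → proj₁ (proj₂ (unb (suc (f n))))) , f∈X
  where
  f : ℕ → ℕ
  f zero    = proj₁ (unb 0)
  f (suc n) = proj₁ (unb (suc (f n)))

  f∈X : ∀ n → f n ∈ X
  f∈X zero    = proj₂ (proj₂ (unb 0))
  f∈X (suc n) = proj₂ (proj₂ (unb (suc (f n))))

-- Infinite pigeonhole and Ramsey's theorem

colour-class-unbounded :
  ExcludedMiddle 0ℓ → (h : ℕ → ℕ) → StrictlyIncreasing h → (c : ℕ → Bool) →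
  ∃[ b ] Unbounded (λ y → ∃[ k ] h k ≡ y × c k ≡ b)
colour-class-unbounded em h h-inc c with em {P = ∃[ n ] (∀ k → n ≤ k → c k ≡ false)}
-- Since `h k` is at least `k`, a lower bound on indices is also one on values; the index `m ⊔ n` is
-- both large and in the tail coloured `false`.
... | yes (n , false-from-n) = false , λ m →
      h (m ⊔ n) , ≤-trans (m≤m⊔n m n) (increasing-expansive h-inc (m ⊔ n)) ,
      m ⊔ n , refl , false-from-n (m ⊔ n) (m≤n⊔m m n)
... | no not-eventually-false = true , unbounded
  where
  unbounded : Unbounded (λ y → ∃[ k ] h k ≡ y × c k ≡ true)
  unbounded n with em {P = ∃[ k ] n ≤ k × c k ≡ true}
  ... | yes (k , n≤k , ck) = h k , ≤-trans n≤k (increasing-expansive h-inc k) , k , refl , ck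
  ... | no none = ⊥-elim (not-eventually-false (n , all-false))
    where
    all-false : ∀ k → n ≤ k → c k ≡ false
    all-false k n≤k with c k Bool.≟ true
    ... | yes ck = contradiction (k , n≤k , ck) none
    ... | no ¬ck with c k
    ...   | true  = contradiction refl ¬ck
    ...   | false = refl

-- Induction on `r`. At each stage one element is fixed, and the induction hypothesis, applied to
-- the lists headed by it, shrinks the rest to a set where they all have one colour. Infinitely many
-- of the fixed elements share that colour by pigeonhole.
ramsey : ExcludedMiddle 0ℓ → ∀ r (c : List ℕ → Bool) {X} → Unbounded X →
         ∃[ Y ] Y ⊆ X × Unbounded Y × ∃[ b ] Homogeneous r c Y b
ramsey em zero    c {X} unb = X , id , unb , c [] , λ { {[]} _ _ _ → refl }
ramsey em (suc r) c {X} unb = Y , Y⊆X , proj₂ dominant , proj₁ dominant , homogeneous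
  where
  -- Some element of the set, not necessarily the least; hence the explicit cut in `Above`.
  first : ∃ Unbounded → ℕ
  first (_ , unb) = proj₁ (unb 0)

  Above : ∃ Unbounded → Pred ℕ 0ℓ
  Above s x = first s < x × x ∈ proj₁ s

  above-unbounded : ∀ s → Unbounded (Above s)
  above-unbounded s@(_ , unb) n with unb (n ⊔ suc (first s))
  ... | m , ≤m , m∈ = m , ≤-trans (m≤m⊔n n _) ≤m , ≤-trans (m≤n⊔m n _) ≤m , m∈

  refine : (s : ∃ Unbounded) →
           ∃[ Z ] Z ⊆ Above s × Unbounded Z × ∃[ b ] Homogeneous r (c ∘ (first s ∷_)) Z b
  refine s = ramsey em r (c ∘ (first s ∷_)) (above-unbounded s)

  stage : ℕ → ∃ Unbounded
  stage zero    = X , unb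
  stage (suc k) = proj₁ (refine (stage k)) , proj₁ (proj₂ (proj₂ (refine (stage k))))

  h : ℕ → ℕ
  h k = first (stage k)

  colour : ℕ → Bool
  colour k = proj₁ (proj₂ (proj₂ (proj₂ (refine (stage k)))))

  h∈stage : ∀ k → h k ∈ proj₁ (stage k)
  h∈stage k = proj₂ (proj₂ (proj₂ (stage k) 0))

  stage-step : ∀ k → proj₁ (stage (suc k)) ⊆ Above (stage k)
  stage-step k = proj₁ (proj₂ (refine (stage k)))

  nested : ∀ {k m} → k ≤ m → proj₁ (stage m) ⊆ proj₁ (stage k)
  nested {k} {m} k≤m with m≤n⇒m<n∨m≡n k≤m
  ... | inj₂ refl = id
  nested {k} {suc m} _ | inj₁ k<1+m = nested (s≤s⁻¹ k<1+m) ∘ proj₂ ∘ stage-step m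

  h-inc : StrictlyIncreasing h
  h-inc = successively λ k → proj₁ (stage-step k (h∈stage (suc k)))

  dominant = colour-class-unbounded em h h-inc colour

  Y : Pred ℕ 0ℓ
  Y y = ∃[ k ] h k ≡ y × colour k ≡ proj₁ dominant

  Y⊆X : Y ⊆ X
  Y⊆X (k , refl , _) = nested {0} {k} z≤n (h∈stage k)

  -- An element `h m` above `h k` has `m` beyond `k`, so it was picked from a set nested in stage
  -- `suc k`, where the colour of lists headed by `h k` is already settled.
  later : ∀ k {y} → h k < y × y ∈ Y → y ∈ proj₁ (stage (suc k))
  later k (hk<y , m , refl , _) = nested {suc k} {m} (increasing-reflects h-inc {k} {m} hk<y) (h∈stage m)

  homogeneous : Homogeneous (suc r) c Y (proj₁ dominant)
  homogeneous {_ ∷ _} refl (h<xs ∷ xs-inc) ((k , refl , ck) ∷ xs∈Y) =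
    trans (proj₂ (proj₂ (proj₂ (proj₂ (refine (stage k))))) refl xs-inc
             (All.zipWith (later k) (h<xs , xs∈Y)))
          ck

-- Sorting by distinct keys, reflection of decisions, infinite ranges

module _ {a : Level} {A : Set a} (key : A → ℕ) where

  private
    keyOrder : DecTotalOrder a 0ℓ 0ℓ
    keyOrder = On.decTotalOrder ≤-decTotalOrder key

  sort-by-key : ∀ xs → AllPairs (_≢_ on key) xs → ∃[ ys ] ys ↭ xs × AllPairs (_<_ on key) ys
  sort-by-key xs distinct = sort xs , sort-↭ xs ,
    AllPairs.zipWith (λ (x≤y , x≢y) → ≤∧≢⇒< x≤y x≢y)
      ( Sorted⇒AllPairs (DecTotalOrder.totalOrder keyOrder) (sort-↗ xs)
      , Permutationₛ.AllPairs-resp-↭ (setoid A) ≢-sym (resp₂ (_≢_ on key))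
          (↭⇒↭ₛ (↭-sym (sort-↭ xs))) distinct)
    where open Data.List.Sort keyOrder

does-true : ∀ {p} {P : Set p} (P? : Dec P) → does P? ≡ true → P
does-true (yes p) _ = p

does-false : ∀ {p} {P : Set p} (P? : Dec P) → does P? ≡ false → ¬ P
does-false (no ¬p) _ = ¬p

range-infinite : ∀ {a} {A : Set a} {z : ℕ → A} → Injective _≡_ _≡_ z → Infinite (range z)
range-infinite {z = z} z-inj (n , f , _ , z⊆f , _)
  with pigeonhole (n<1+n n) (λ i → proj₁ (z⊆f (toℕ i , refl)))
... | i , j , i<j , eq = <-irrefl (z-inj zi≡zj) i<j
  where
  zi≡zj : z (toℕ i) ≡ z (toℕ j)
  zi≡zj = trans (sym (proj₂ (z⊆f (toℕ i , refl))))
                (trans (cong f eq) (proj₂ (z⊆f (toℕ j , refl))))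

-- Disjoint independent blocks

module _ (em : ∀ {ℓ} → ExcludedMiddle ℓ) {a e : Level} {q : ℕ} (H : Hypergraph q a e) where

  private
    V : Set a
    V = Vertex H

  Independent-⊆ : {I J : Pred V a} → J ⊆ I → Independent H I → Independent H J
  Independent-⊆ J⊆I indep E S⊆J = indep E (J⊆I ∘ S⊆J)

  record DisjointBlocks : Set (Level.suc a Level.⊔ e) where
    field
      block             : ∀ n → Fin (suc n) → V
      block-injective   : ∀ {m n i j} → block m i ≡ block n j → m ≡ n × toℕ i ≡ toℕ j
      block-independent : ∀ n → Independent H (range (block n))

  module _ (large : ArbitrarilyLargeFiniteIndependent H) where

    -- Induction on `L`: each forbidden vertex costs at most one point. Of `suc n` points avoiding
    -- the tail, the one equal to `v` is dropped, or the first if there is none.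
    fresh : ∀ (L : List V) n →
            ∃[ f ] Injective {A = Fin n} _≡_ _≡_ f × (∀ i → f i ∉ L) × Independent H (range f)
    fresh [] n with large n
    ... | m , n≤m , I , (f , f-inj , _ , f⊆I) , indep =
      (λ i → f (inject≤ i n≤m)) ,
      (λ eq → inject≤-injective n≤m n≤m _ _ (f-inj eq)) ,
      (λ _ ()) ,
      Independent-⊆ (λ { (i , eq) → f⊆I (inject≤ i n≤m , eq) }) indep
    fresh (v ∷ L) n with fresh L (suc n)
    ... | f , f-inj , f∉L , indep with em {P = v ∈ range f}
    ...   | yes (i , fi≡v) =
      f ∘ punchIn i ,
      (λ eq → punchIn-injective i _ _ (f-inj eq)) ,
      (λ { j (here eq)  → punchInᵢ≢i i j (f-inj (trans eq (sym fi≡v)))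
         ; j (there ∈L) → f∉L _ ∈L }) ,
      Independent-⊆ (λ { (j , eq) → punchIn i j , eq }) indep
    ...   | no v∉f =
      f ∘ suc ,
      (λ eq → suc-injective (f-inj eq)) ,
      (λ { j (here eq)  → v∉f (suc j , eq)
         ; j (there ∈L) → f∉L _ ∈L }) ,
      Independent-⊆ (λ { (j , eq) → suc j , eq }) indep

    disjointBlocks : DisjointBlocks
    disjointBlocks = record
      { block             = block
      ; block-injective   = block-injective
      ; block-independent = λ n → proj₂ (proj₂ (proj₂ (fresh (used n) (suc n))))
      }
      where
      -- `used n` lists the vertices of all blocks before the `n`-th, and block `n` is chosen fresh
      -- from it.
      used  : ℕ → List V
      block : ∀ n → Fin (suc n) → V
      used zero    = []
      used (suc n) = tabulate (block n) ++ used n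
      block n      = proj₁ (fresh (used n) (suc n))

      block∈used : ∀ {m n} i → m < n → block m i ∈ˡ used n
      block∈used {m} {suc n} i m<1+n with m≤n⇒m<n∨m≡n (s≤s⁻¹ m<1+n)
      ... | inj₁ m<n  = ∈-++⁺ʳ (tabulate (block n)) (block∈used i m<n)
      ... | inj₂ refl = ∈-++⁺ˡ (∈-tabulate⁺ {f = block m} i)

      block∉used : ∀ n i → block n i ∉ used n
      block∉used n = proj₁ (proj₂ (proj₂ (fresh (used n) (suc n))))

      block-injective : ∀ {m n i j} → block m i ≡ block n j → m ≡ n × toℕ i ≡ toℕ j
      block-injective {m} {n} {i} {j} eq with <-cmp m n
      ... | tri< m<n _ _  = contradiction (subst (_∈ˡ used n) eq (block∈used i m<n)) (block∉used n j)
      ... | tri≈ _ refl _ = refl , cong toℕ (proj₁ (proj₂ (fresh (used m) (suc m))) eq)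
      ... | tri> _ _ n<m  = contradiction (subst (_∈ˡ used m) (sym eq) (block∈used j n<m)) (block∉used m i)

  -- Windows along a homogeneous sequence

  module Windows (blocks : DisjointBlocks) (t : ℕ) where

    open DisjointBlocks blocks

    -- A total version of block, meaningful for i ≤ n only.
    x : ℕ → ℕ → V
    x n i = block n (i mod suc n)

    x-injective : ∀ {m n i j} → i ≤ m → j ≤ n → x m i ≡ x n j → m ≡ n × i ≡ j
    x-injective {m} {n} {i} {j} i≤m j≤n eq with block-injective eq
    ... | m≡n , eq′ = m≡n , trans (sym (toℕ-mod i≤m)) (trans eq′ (toℕ-mod j≤n))
      where
      toℕ-mod : ∀ {n i} → i ≤ n → toℕ (i mod suc n) ≡ i
      toℕ-mod i≤n = trans (toℕ-fromℕ< _) (m≤n⇒m%n≡m i≤n)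

    -- Consecutive entries `a`, `b` code the point at position `a` of block `b`, so an increasing
    -- list of length `q * 2` codes `q` points from distinct blocks.
    points : List ℕ → List V
    points (a ∷ b ∷ xs) = x b a ∷ points xs
    points _            = []

    -- Excluded middle turns edgehood, a statement at level `e`, into a Boolean colour of lists.
    edge? : (xs : List ℕ) → Dec (Edge H (_∈ˡ points xs))
    edge? xs = em

    homogeneous-sequence : ∃[ g ] StrictlyIncreasing g ×
                           ∃[ b ] Homogeneous (q * 2) (does ∘ edge?) (range g) b
    -- The predicate `n ≡ n` is the set of all naturals.
    homogeneous-sequence with ramsey em (q * 2) (does ∘ edge?) {λ n → n ≡ n} (λ n → n , ≤-refl , refl)
    ... | Y , _ , Y-unb , b , hom with enumerate Y-unb
    ...   | g , g-inc , g∈Y =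
      g , g-inc , b , λ len inc xs∈ → hom len inc (All.map (λ { (k , refl) → g∈Y k }) xs∈)

    g : ℕ → ℕ
    g = proj₁ homogeneous-sequence

    g-inc : StrictlyIncreasing g
    g-inc = proj₁ (proj₂ homogeneous-sequence)

    answer : Bool
    answer = proj₁ (proj₂ (proj₂ homogeneous-sequence))

    -- The pair `(k , j)` is position `j` of window `k`. A window occupies `suc t` terms of `g`: the
    -- first `t` serve as slots and the last is the number of the block.
    Slot : Set
    Slot = ℕ × Fin t

    -- Abstract, so that slots can be inferred from the vertices they name.
    abstract
      lower : Slot → ℕ
      lower (k , j) = g (k * suc t + toℕ j)

      upper : ℕ → ℕ
      upper k = g (k * suc t + t)

      vertex : Slot → V
      vertex s = x (upper (proj₁ s)) (lower s)

      lower∈range : ∀ s → lower s ∈ range g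
      lower∈range (k , j) = k * suc t + toℕ j , refl

      upper∈range : ∀ k → upper k ∈ range g
      upper∈range k = k * suc t + t , refl

      vertex∈block : ∀ s → vertex s ∈ range (block (upper (proj₁ s)))
      vertex∈block _ = _ , refl

      vertex≡x : ∀ s → vertex s ≡ x (upper (proj₁ s)) (lower s)
      vertex≡x _ = refl

      lower<upper : ∀ s → lower s < upper (proj₁ s)
      lower<upper (k , j) = g-inc (+-monoʳ-< (k * suc t) (toℕ<n j))

      upper<lower : ∀ {k} s → k < proj₁ s → upper k < lower s
      upper<lower {k} (l , j) k<l =
        g-inc (<-≤-trans before (≤-trans (*-monoˡ-≤ (suc t) k<l) (m≤m+n (l * suc t) (toℕ j))))
        where
        before : k * suc t + t < suc k * suc t
        before = subst (_< suc k * suc t) (+-comm t (k * suc t)) (n<1+n (t + k * suc t))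

      lower-injective : ∀ {k i j} → lower (k , i) ≡ lower (k , j) → i ≡ j
      lower-injective {k} {i} {j} eq =
        toℕ-injective (+-cancelˡ-≡ (k * suc t) (toℕ i) (toℕ j) (increasing-injective g-inc eq))

    upper-inc : Fin t → StrictlyIncreasing upper
    upper-inc j {_} {l} k<l = <-trans (upper<lower (l , j) k<l) (lower<upper (l , j))

    -- Equal vertices lie in one block, which fixes `upper` and hence the window; the position
    -- within the block then fixes the slot.
    vertex-injective : Injective _≡_ _≡_ vertex
    vertex-injective {k , i} {l , j} eq
      with x-injective (<⇒≤ (lower<upper (k , i))) (<⇒≤ (lower<upper (l , j)))
             (subst₂ _≡_ (vertex≡x (k , i)) (vertex≡x (l , j)) eq)
    ... | upper≡ , lower≡ with increasing-injective (upper-inc i) upper≡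
    ...   | refl = cong (k ,_) (lower-injective lower≡)

    indices : List Slot → List ℕ
    indices []      = []
    indices (s ∷ l) = lower s ∷ upper (proj₁ s) ∷ indices l

    length-indices : ∀ l → length (indices l) ≡ length l * 2
    length-indices []      = refl
    length-indices (s ∷ l) = cong (2 +_) (length-indices l)

    points-indices : ∀ l → points (indices l) ≡ map vertex l
    points-indices []      = refl
    points-indices (s ∷ l) = cong₂ _∷_ (sym (vertex≡x s)) (points-indices l)

    indices∈range : ∀ l → All (_∈ range g) (indices l)
    indices∈range []      = []
    indices∈range (s ∷ l) = lower∈range s ∷ upper∈range (proj₁ s) ∷ indices∈range l

    upper<indices : ∀ {k l} → All (λ s → k < proj₁ s) l → All (upper k <_) (indices l)
    upper<indices []                   = []
    upper<indices {l = s ∷ _} (k< ∷ p) =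
      upper<lower s k< ∷ <-trans (upper<lower s k<) (lower<upper s) ∷ upper<indices p

    indices-increasing : ∀ {l} → AllPairs (_<_ on proj₁) l → AllPairs _<_ (indices l)
    indices-increasing []               = []
    indices-increasing {s ∷ _} (k< ∷ p) =
      (lower<upper s ∷ All.map (<-trans (lower<upper s)) (upper<indices k<)) ∷
      upper<indices k< ∷ indices-increasing p

    -- Sorting the slots by window makes their `indices` an increasing list in the range of `g`,
    -- whose colour is `answer`. Its points are those of `S` in another order, and `edge-resp`
    -- transfers the verdict.
    edge-answer : ∀ {S} (p : Fin q → Slot) → Injective _≡_ _≡_ (proj₁ ∘ p) → S ≐ range (vertex ∘ p) →
                  (answer ≡ true → Edge H S) × (answer ≡ false → ¬ Edge H S)
    edge-answer {S} p p-inj (S⊆ , ⊆S)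
      with sort-by-key proj₁ (tabulate p) (AllPairs.tabulate⁺ (λ i≢j eq → i≢j (p-inj eq)))
    ... | l , l↭p , l-inc =
      (λ always → edge-resp H (⊆S ∘ from , to ∘ S⊆) (does-true (edge? (indices l)) (trans decided always))) ,
      (λ never E → does-false (edge? (indices l)) (trans decided never) (edge-resp H (to ∘ S⊆ , ⊆S ∘ from) E))
      where
      decided : does (edge? (indices l)) ≡ answer
      decided = proj₂ (proj₂ (proj₂ homogeneous-sequence))
        (trans (length-indices l) (cong (_* 2) (trans (↭-length l↭p) (length-tabulate p))))
        (indices-increasing l-inc) (indices∈range l)

      to : range (vertex ∘ p) ⊆ (_∈ˡ points (indices l))
      to (i , refl) = subst (_ ∈ˡ_) (sym (points-indices l))
        (∈-map⁺ vertex (∈-resp-↭ (↭-sym l↭p) (∈-tabulate⁺ {f = p} i)))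

      from : (_∈ˡ points (indices l)) ⊆ range (vertex ∘ p)
      from v∈ with ∈-map⁻ vertex (subst (_ ∈ˡ_) (points-indices l) v∈)
      ... | s , s∈l , v≡ with ∈-tabulate⁻ {f = p} (∈-resp-↭ l↭p s∈l)
      ...   | i , s≡ = i , sym (trans v≡ (cong vertex s≡))

    -- Choosing the slot of each element of `S` gives pairwise distinct windows, because `one`
    -- forbids two slots in the same window.
    transversal-answer : ∀ {S} → HasSize S q → S ⊆ range vertex →
                         (∀ {k i j} → vertex (k , i) ∈ S → vertex (k , j) ∈ S → i ≡ j) →
                         (answer ≡ true → Edge H S) × (answer ≡ false → ¬ Edge H S)
    transversal-answer {S} (f , f-inj , S⊆f , f⊆S) slotted one =
      edge-answer p p-inj ((λ v∈S → vertex∘p (S⊆f v∈S)) , λ { (i , refl) → p∈S i })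
      where
      p : Fin q → Slot
      p i = proj₁ (slotted (f⊆S (i , refl)))

      p-correct : ∀ i → vertex (p i) ≡ f i
      p-correct i = proj₂ (slotted (f⊆S (i , refl)))

      p∈S : ∀ i → vertex (p i) ∈ S
      p∈S i = f⊆S (i , sym (p-correct i))

      vertex∘p : range f ⊆ range (vertex ∘ p)
      vertex∘p (i , fi≡v) = i , trans (p-correct i) fi≡v

      same-window : ∀ {s s′} → vertex s ∈ S → vertex s′ ∈ S → proj₁ s ≡ proj₁ s′ → s ≡ s′
      same-window s∈S s′∈S refl = cong (_ ,_) (one s∈S s′∈S)

      p-inj : Injective _≡_ _≡_ (proj₁ ∘ p)
      p-inj {i} {j} eq = f-inj (trans (sym (p-correct i))
        (trans (cong vertex (same-window (p∈S i) (p∈S j) eq)) (p-correct j)))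

    -- The two values of the colour

    infinite-independent : Fin t → answer ≡ false → HasInfiniteIndependent H
    infinite-independent j₀ never = range z , range-infinite z-inj , independent
      where
      z : ℕ → V
      z k = vertex (k , j₀)

      z-inj : Injective _≡_ _≡_ z
      z-inj eq = cong proj₁ (vertex-injective eq)

      vertex∈z : ∀ {k i} → vertex (k , i) ∈ range z → j₀ ≡ i
      vertex∈z (_ , eq) = cong proj₂ (vertex-injective eq)

      independent : Independent H (range z)
      -- An edge has size `q` by `edge-size`, and inside `range z` it can only use slot `j₀` of each
      -- window.
      independent E S⊆z = proj₂ (transversal-answer (edge-size H E)
        (λ v∈S → let k , eq = S⊆z v∈S in (k , j₀) , eq)
        (λ u∈S v∈S → trans (sym (vertex∈z (S⊆z u∈S))) (vertex∈z (S⊆z v∈S)))) never E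

    G : Hypergraph q a e
    G = induced H (range vertex)

    windows-inM : answer ≡ true → InM t G
    windows-inM always = record
      { part       = part
      ; part-size  = λ k → (λ j → vertex (k , j) , [ (k , j) , refl ]) ,
                           (λ eq → cong proj₂ (vertex-injective (cong value eq))) ,
                           (λ (j , eq) → j , value-injective eq) ,
                           (λ (j , eq) → j , cong value eq)
      ; covering   = λ v → let (k , j) , eq = slot v in k , j , eq
      ; disjoint   = λ (i , eq) (j , eq′) → cong proj₁ (vertex-injective (trans eq (sym eq′)))
      ; transverse = λ {S} size one → proj₁ (transversal-answer {image value S} (image-size size)
                       (λ { (v , _ , refl) → slot v })
                       (λ { (u , u∈S , eq) (v , v∈S , eq′) →
                              cong proj₂ (vertex-injective (trans (sym eq) (trans
                                (cong value (one _ u∈S v∈S (_ , sym eq) (_ , sym eq′))) eq′))) })) always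
      -- Window `k` lies inside the single independent block `upper k`.
      ; no-inner   = λ E k S⊆part → block-independent (upper k) E
                       λ { (v , v∈S , refl) → let j , eq = S⊆part v∈S in
                           subst (_∈ range (block (upper k))) eq (vertex∈block (k , j)) }
      }
      where
      part : ℕ → Pred (Vertex G) a
      part k v = ∃[ j ] vertex (k , j) ≡ value v

      slot : (v : Vertex G) → value v ∈ range vertex
      -- A refinement stores membership irrelevantly; `recompute` obtains a relevant proof from the
      -- decision given by excluded middle.
      slot (_ , [ p ]) = recompute em p

      image-size : ∀ {S} → HasSize S q → HasSize (image value S) q
      image-size (f , f-inj , S⊆f , f⊆S) =
        value ∘ f , (λ eq → f-inj (value-injective eq)) ,
        (λ { (v , v∈S , refl) → let i , eq = S⊆f v∈S in i , cong value eq }) ,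
        (λ { (i , refl) → f i , f⊆S (i , refl) , refl })

≅-refl : ∀ {q a e} {G : Hypergraph q a e} → G ≅ G
≅-refl {G = G} = record
  { bijection = ↔-id _
  ; edges     = λ S → mk⇔ (edge-resp G ((λ x∈S → _ , x∈S , refl) , λ { (_ , x∈S , refl) → x∈S }))
                          (edge-resp G ((λ { (_ , x∈S , refl) → x∈S }) , λ x∈S → _ , x∈S , refl))
  }

theorem18 : (∀ {ℓ} → ExcludedMiddle ℓ) →
    {a e : Level} (q t : ℕ) → .{{_ : NonZero q}} → .{{_ : NonZero t}} →
    (H : Hypergraph q a e) → MFree t H →
    ArbitrarilyLargeFiniteIndependent H → HasInfiniteIndependent H
theorem18 em q t@(suc _) H free large = by-answer answer refl
  where
  open Windows em H (disjointBlocks em H large) t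

  by-answer : ∀ b → answer ≡ b → HasInfiniteIndependent H
  -- As `t` is a successor, `zero` is a slot of every window.
  by-answer false never  = infinite-independent zero never
  -- The subhypergraph induced on the windows is itself the forbidden member, so the identity
  -- isomorphism contradicts freeness.
  by-answer true  always = ⊥-elim (free (range vertex) G (windows-inM always) ≅-refl)
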